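{- For all integers $n\geq 3$, $\overline{p}_{\mathrm{eu}}^{\mathrm{ou}}(2n)<\overline{p}^{\mathrm{eu}}_{\mathrm{ou}}(2n+1)$.
   Context: A partition of a non-negative integer $m$ is a non-increasing finite sequence of positive integers, called parts, summing to $m$. The multiplicity of a part is the number of times it occurs. $\overline{p}_{\mathrm{eu}}^{\mathrm{ou}}(m)$ is the number of partitions of $m$ in which every odd part is larger than every even part, the largest even part appears with odd multiplicity, and all other parts (even or odd) appear with even multiplicity. Partitions with no odd parts are allowed. Partitions with only odd parts are also allowed: such a partition is regarded as having a single even part equal to $0$ with multiplicity one, so it is counted exactly when all of its (odd) parts appear with even multiplicity. $\overline{p}^{\mathrm{eu}}_{\mathrm{ou}}(m)$ is the number of partitions of $m$ in which every even part is larger than every odd part, both even and odd parts occur (at least one of each), the largest even part and the largest odd part each appear with odd multiplicity, and all other parts appear with even multiplicity. -}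

module Defs where

open import Data.List using (List; []; _∷_; _++_; concat; filter; length; map; replicate; upTo)
open import Data.List.Membership.Propositional using (_∈_)
open import Data.List.Membership.Propositional.Properties
  using (∈-map⁺; ∈-map⁻; ∈-concat⁺′; ∈-concat⁻′; ∈-upTo⁺; ∈-upTo⁻)
open import Data.List.Properties using (++-cancelˡ; ∷-injectiveʳ)
open import Data.List.Relation.Binary.Disjoint.Propositional using (Disjoint)
open import Data.List.Relation.Unary.All as All using (All; []; _∷_; all?)
import Data.List.Relation.Unary.All.Properties as All
open import Data.List.Relation.Unary.AllPairs as AllPairs using (AllPairs; []; _∷_)
import Data.List.Relation.Unary.AllPairs.Properties as AllPairs
open import Data.List.Relation.Unary.Any using (Any; here; any?)
open import Data.List.Relation.Unary.Linked using (Linked)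
open import Data.List.Relation.Unary.Linked.Properties using (Linked⇒AllPairs; AllPairs⇒Linked)
open import Data.List.Relation.Unary.Unique.Propositional using (Unique)
import Data.List.Relation.Unary.Unique.Propositional.Properties as Unique
open import Data.Nat
open import Data.Nat.Divisibility using (_∣_; _∣?_)
open import Data.Nat.DivMod using (m/n*n≤m; m*n/n≡m; /-monoˡ-≤)
open import Data.Nat.ListAction using (sum)
open import Data.Nat.ListAction.Properties using (sum-++)
open import Data.Nat.Properties
open import Data.Product using (∃-syntax; _×_; _,_; proj₁; proj₂)
open import Data.Sum using (_⊎_)
open import Function using (_∘_)
open import Level using (0ℓ)
open import Relation.Binary.PropositionalEquality
open import Relation.Nullary using (¬_; ¬?; yes; no; contradiction)
open import Relation.Nullary.Decidable using (_×-dec_; _⊎-dec_; _→-dec_)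
open import Relation.Unary using (Pred; Decidable)

record IsPartition (m : ℕ) (xs : List ℕ) : Set where
  constructor isPartition
  field
    nonIncreasing : Linked _≥_ xs
    positive      : All (0 <_) xs
    sum≡          : sum xs ≡ m

-- partitionsUpTo k m lists the partitions of m with all parts ≤ k, grouped by
-- the multiplicity i of the part k.
partitionsUpTo : ℕ → ℕ → List (List ℕ)

partitionsWith : ℕ → ℕ → ℕ → List (List ℕ)
partitionsWith k m i = map (replicate i (suc k) ++_) (partitionsUpTo k (m ∸ i * suc k))

partitionsUpTo zero    zero    = [] ∷ []
partitionsUpTo zero    (suc m) = []
partitionsUpTo (suc k) m       = concat (map (partitionsWith k m) (upTo (suc (m / suc k))))

partitions : ℕ → List (List ℕ)
partitions m = partitionsUpTo m m

mult : ℕ → List ℕ → ℕ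
mult k xs = length (filter (_≟ k) xs)

Even Odd : Pred ℕ 0ℓ
Even n = 2 ∣ n
Odd n = ¬ Even n

even? : Decidable Even
even? = 2 ∣?_

odd? : Decidable Odd
odd? n = ¬? (even? n)

_AllAbove_In_ : Pred ℕ 0ℓ → Pred ℕ 0ℓ → Pred (List ℕ) 0ℓ
P AllAbove Q In xs = All (λ a → All (λ b → P a → Q b → b < a) xs) xs

-- Membership of k in xs is supplied by the surrounding Any in OU/EU and EU/OU.
IsLargest : Pred ℕ 0ℓ → ℕ → Pred (List ℕ) 0ℓ
IsLargest P k xs = P k × All (λ a → P a → a ≤ k) xs

-- The second alternative covers the partitions without even parts, whose
-- largest even part is by convention a single 0.
OU/EU : Pred (List ℕ) 0ℓ
OU/EU xs =
  Odd AllAbove Even In xs ×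
  ( Any (λ k → IsLargest Even k xs × Odd (mult k xs) ×
               All (λ a → a ≢ k → Even (mult a xs)) xs) xs
  ⊎ (All Odd xs × All (λ a → Even (mult a xs)) xs) )

EU/OU : Pred (List ℕ) 0ℓ
EU/OU xs =
  Even AllAbove Odd In xs ×
  Any (λ k → Any (λ l →
    IsLargest Even k xs × Odd (mult k xs) ×
    IsLargest Odd l xs × Odd (mult l xs) ×
    All (λ a → a ≢ k → a ≢ l → Even (mult a xs)) xs) xs) xs

allAbove? : ∀ {P Q : Pred ℕ 0ℓ} → Decidable P → Decidable Q → Decidable (P AllAbove Q In_)
allAbove? P? Q? xs = all? (λ a → all? (λ b → P? a →-dec (Q? b →-dec (b <? a))) xs) xs

isLargest? : ∀ {P : Pred ℕ 0ℓ} → Decidable P → ∀ k → Decidable (IsLargest P k)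
isLargest? P? k xs = P? k ×-dec all? (λ a → P? a →-dec (a ≤? k)) xs

ou/eu? : Decidable OU/EU
ou/eu? xs =
  allAbove? odd? even? xs ×-dec
  ( any? (λ k → isLargest? even? k xs ×-dec odd? (mult k xs) ×-dec
                all? (λ a → ¬? (a ≟ k) →-dec even? (mult a xs)) xs) xs
  ⊎-dec (all? odd? xs ×-dec all? (λ a → even? (mult a xs)) xs) )

eu/ou? : Decidable EU/OU
eu/ou? xs =
  allAbove? even? odd? xs ×-dec
  any? (λ k → any? (λ l →
    isLargest? even? k xs ×-dec odd? (mult k xs) ×-dec
    isLargest? odd? l xs ×-dec odd? (mult l xs) ×-dec
    all? (λ a → ¬? (a ≟ k) →-dec (¬? (a ≟ l) →-dec even? (mult a xs))) xs) xs) xs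

-- Superscript and subscript of p̄ are read top to bottom as upper/lower: the
-- class written first has the larger parts.
p-ou/eu : ℕ → ℕ
p-ou/eu m = length (filter ou/eu? (partitions m))

p-eu/ou : ℕ → ℕ
p-eu/ou m = length (filter eu/ou? (partitions m))

-- The rest of the module checks that partitions m lists every partition of m
-- exactly once, so that the lengths above are the intended cardinalities.

private
  Sorted : Pred (List ℕ) 0ℓ
  Sorted = AllPairs _≥_

  sum-replicate : ∀ i k → sum (replicate i k) ≡ i * k
  sum-replicate zero    k = refl
  sum-replicate (suc i) k = cong (k +_) (sum-replicate i k)

  sum-block : ∀ i k ys → sum (replicate i k ++ ys) ≡ i * k + sum ys
  sum-block i k ys = trans (sum-++ (replicate i k) ys) (cong (_+ sum ys) (sum-replicate i k))

  sorted-block : ∀ i {k ys} → All (_≤ k) ys → Sorted ys → Sorted (replicate i k ++ ys)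
  sorted-block zero    _  s = s
  sorted-block (suc i) ≤k s =
    All.++⁺ (All.replicate⁺ i ≤-refl) ≤k ∷ sorted-block i ≤k s

  sound : ∀ k m {xs} → xs ∈ partitionsUpTo k m →
          Sorted xs × All (0 <_) xs × All (_≤ k) xs × sum xs ≡ m
  sound zero    zero    (here refl) = [] , [] , [] , refl
  sound (suc k) m       xs∈ with ∈-concat⁻′ (map (partitionsWith k m) (upTo (suc (m / suc k)))) xs∈
  ... | _ , xs∈ps , ps∈ with ∈-map⁻ (partitionsWith k m) ps∈
  ... | i , i∈ , refl with ∈-map⁻ (replicate i (suc k) ++_) xs∈ps
  ... | ys , ys∈ , refl with sound k (m ∸ i * suc k) ys∈
  ... | s , pos , ≤k , eq =
    sorted-block i (All.map m≤n⇒m≤1+n ≤k) s ,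
    All.++⁺ (All.replicate⁺ i z<s) pos ,
    All.++⁺ (All.replicate⁺ i ≤-refl) (All.map m≤n⇒m≤1+n ≤k) ,
    (begin
      sum (replicate i (suc k) ++ ys)     ≡⟨ sum-block i (suc k) ys ⟩
      i * suc k + sum ys                  ≡⟨ cong (i * suc k +_) eq ⟩
      i * suc k + (m ∸ i * suc k)         ≡⟨ m+[n∸m]≡n i*k≤m ⟩
      m                                   ∎)
    where
    open ≡-Reasoning
    i*k≤m : i * suc k ≤ m
    i*k≤m = ≤-trans (*-monoˡ-≤ (suc k) (s≤s⁻¹ (∈-upTo⁻ i∈))) (m/n*n≤m m (suc k))

  split : ∀ k {xs} → Sorted xs → All (_≤ suc k) xs →
          ∃[ i ] ∃[ ys ] xs ≡ replicate i (suc k) ++ ys × All (_≤ k) ys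
  split k {[]} _ _ = 0 , [] , refl , []
  split k {x ∷ xs} (≥xs ∷ s) (x≤ ∷ ≤k) with x ≟ suc k
  ... | no x≢ = 0 , x ∷ xs , refl , x≤k ∷ All.map (λ y≤x → ≤-trans y≤x x≤k) ≥xs
    where
    x≤k : x ≤ k
    x≤k = s≤s⁻¹ (≤∧≢⇒< x≤ x≢)
  ... | yes refl with split k s ≤k
  ... | i , ys , refl , ≤ys = suc i , ys , refl , ≤ys

  dropBlock : ∀ i {k ys} → Sorted (replicate i k ++ ys) → Sorted ys
  dropBlock zero    s       = s
  dropBlock (suc i) (_ ∷ s) = dropBlock i s

  complete : ∀ k {xs} → Sorted xs → All (0 <_) xs → All (_≤ k) xs →
             xs ∈ partitionsUpTo k (sum xs)
  complete zero    {[]}    _ _ _ = here refl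
  complete zero    {_ ∷ _} _ (0<x ∷ _) (x≤0 ∷ _) = contradiction 0<x (≤⇒≯ x≤0)
  complete (suc k) s pos ≤k with split k s ≤k
  ... | i , ys , refl , ≤ys =
    ∈-concat⁺′ (∈-map⁺ (replicate i (suc k) ++_) ys∈) (∈-map⁺ (partitionsWith k m) (∈-upTo⁺ (s≤s i≤)))
    where
    m : ℕ
    m = sum (replicate i (suc k) ++ ys)
    eq : m ≡ i * suc k + sum ys
    eq = sum-block i (suc k) ys
    ys∈ : ys ∈ partitionsUpTo k (m ∸ i * suc k)
    ys∈ = subst (λ j → ys ∈ partitionsUpTo k j)
      (sym (trans (cong (_∸ i * suc k) eq) (m+n∸m≡n (i * suc k) (sum ys))))
      (complete k (dropBlock i s) (All.++⁻ʳ (replicate i (suc k)) pos) ≤ys)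
    i≤ : i ≤ m / suc k
    i≤ = subst (_≤ m / suc k) (m*n/n≡m i (suc k))
      (/-monoˡ-≤ (suc k) (subst (i * suc k ≤_) (sym eq) (m≤m+n (i * suc k) (sum ys))))

  block-injective : ∀ i j {k ys zs} → All (_≤ k) ys → All (_≤ k) zs →
                    replicate i (suc k) ++ ys ≡ replicate j (suc k) ++ zs → i ≡ j
  block-injective zero    zero    _ _ _ = refl
  block-injective zero    (suc j) (k<k ∷ _) _ refl = contradiction k<k (<-irrefl refl)
  block-injective (suc i) zero    _ (k<k ∷ _) refl = contradiction k<k (<-irrefl refl)
  block-injective (suc i) (suc j) ≤ys ≤zs eq =
    cong suc (block-injective i j ≤ys ≤zs (∷-injectiveʳ eq))

  unique : ∀ k m → Unique (partitionsUpTo k m)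
  unique zero    zero    = [] ∷ []
  unique zero    (suc m) = []
  unique (suc k) m = Unique.concat⁺
    (All.map⁺ (All.universal
      (λ i → Unique.map⁺ (++-cancelˡ (replicate i (suc k)) _ _) (unique k (m ∸ i * suc k)))
      (upTo (suc (m / suc k)))))
    (AllPairs.map⁺ (AllPairs.map disjoint (Unique.upTo⁺ (suc (m / suc k)))))
    where
    disjoint : ∀ {i j} → i ≢ j → Disjoint (partitionsWith k m i) (partitionsWith k m j)
    disjoint {i} {j} i≢j (v∈i , v∈j)
      with ∈-map⁻ (replicate i (suc k) ++_) v∈i | ∈-map⁻ (replicate j (suc k) ++_) v∈j
    ... | ys , ys∈ , eq₁ | zs , zs∈ , eq₂ = i≢j (block-injective i j
      (bounded (m ∸ i * suc k) ys∈) (bounded (m ∸ j * suc k) zs∈) (trans (sym eq₁) eq₂))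
      where
      bounded : ∀ n {xs} → xs ∈ partitionsUpTo k n → All (_≤ k) xs
      bounded n = proj₁ ∘ proj₂ ∘ proj₂ ∘ sound k n

  parts≤sum : ∀ xs → All (_≤ sum xs) xs
  parts≤sum []       = []
  parts≤sum (x ∷ xs) =
    m≤m+n x (sum xs) ∷ All.map (λ y≤ → ≤-trans y≤ (m≤n+m (sum xs) x)) (parts≤sum xs)

∈-partitions⁻ : ∀ {m xs} → xs ∈ partitions m → IsPartition m xs
∈-partitions⁻ {m} xs∈ =
  let s , pos , _ , eq = sound m m xs∈ in isPartition (AllPairs⇒Linked s) pos eq

∈-partitions⁺ : ∀ {m xs} → IsPartition m xs → xs ∈ partitions m
∈-partitions⁺ {xs = xs} (isPartition s pos refl) =
  complete (sum xs) (Linked⇒AllPairs (λ x≥y y≥z → ≤-trans y≥z x≥y) s) pos (parts≤sum xs)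

partitions-unique : ∀ m → Unique (partitions m)
partitions-unique m = unique m m

{-# OPTIONS --safe #-}
module Submission where

-- Both classes consist of equal pairs of parts, up to a lone even part 2 k and, in
-- EU/OU, a lone odd part. An OU/EU partition of 2 n with lone part 2 k is turned into
-- a partition with odd parts only: 2 k becomes 2 k ones, a pair of parts 2 i > 2
-- becomes two parts 2 i - 1 and two ones, and the pairs of twos are set aside. The
-- number of ones is then 2 k plus the number of parts strictly between 1 and 2 k,
-- which is strictly increasing in k, so k can be recovered. If there is no even part,
-- two ones (if any) are set aside instead: half the sum of what is set aside is then 1,
-- but it is even in the former case. Conjugation turns the odd parts, which form pairs,
-- into even parts: one equal to the number of these parts, followed by pairs. What was
-- set aside is appended as ones, together with one further 1. Every image contains a 1,
-- so the partition 2 (n - 1) + 3 is missed.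

open import Defs
open import Data.Nat using (ℕ; _+_; _*_; _≤_; _<_)
open import Data.Nat using (zero; suc; _≥_; _≟_; z≤n; s≤s; z<s; s≤s⁻¹)
open import Data.List using (List; []; _∷_; [_]; _++_; filter; foldr; length; map; replicate)
open import Data.List.Membership.DecPropositional _≟_ using (_∈?_)
open import Data.List.Membership.Propositional using (_∈_; find; lose)
open import Data.List.Membership.Propositional.Properties
  using (∈-∃++; ∈-insert; ∈-++⁺ˡ; ∈-++⁺ʳ; ∈-++⁻; ∈-filter⁺; ∈-filter⁻)
open import Data.List.Properties
  using (filter-++; filter-accept; filter-none; filter-reject; length-++; length-++-sucʳ;
         length-replicate; map-injective; ++-assoc; ++-identityʳ; ∷-injective)
open import Data.List.Relation.Unary.All as All using (All; []; _∷_)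
import Data.List.Relation.Unary.All.Properties as All
open import Data.List.Relation.Unary.AllPairs as AllPairs using (AllPairs; []; _∷_)
import Data.List.Relation.Unary.AllPairs.Properties as AllPairs
open import Data.List.Relation.Unary.Any using (here; there)
open import Data.List.Relation.Unary.Linked.Properties using (AllPairs⇒Linked; Linked⇒AllPairs)
open import Data.List.Relation.Unary.Unique.Propositional using (Unique)
import Data.List.Relation.Unary.Unique.Propositional.Properties as Unique
open import Data.Nat.Divisibility using (divides; ∣-refl; ∣m+n∣m⇒∣n; ∣m∣n⇒∣m+n; m∣m*n; _∣0)
open import Data.Nat.ListAction using (sum)
open import Data.Nat.ListAction.Properties using (sum-++)
open import Data.Nat.Properties
  using (*-cancelˡ-<; *-cancelˡ-≡; *-cancelˡ-≤; *-comm; *-monoʳ-≤; *-zeroʳ; +-cancelʳ-≡; +-comm;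
         +-identityʳ; +-suc; ≤-antisym; ≤-refl; ≤-reflexive; ≤-total; ≤-trans; ≤⇒≯; ≤∧≢⇒<; ≤-<-trans;
         <-irrefl; <-≤-trans; <⇒≤; <⇒≢; m≤m+n; m≤n+m; m≤n⇒m≤1+n; suc-injective)
open import Data.Nat.Tactic.RingSolver using (solve-∀)
open import Data.Product using (∃-syntax; ∃₂; _×_; _,_; proj₁; proj₂)
open import Data.Sum using (_⊎_; inj₁; inj₂)
open import Function using (_∘_)
open import Relation.Binary.PropositionalEquality hiding ([_])
open import Relation.Nullary using (¬_; yes; no; contradiction)
open import Relation.Nullary.Decidable using (decidable-stable)

private variable
  A B : Set
  a k m n : ℕ
  xs ys zs : List ℕ

-- Comparing cardinalities through injective relations.

-- By induction, striking the partner of `x` from `ys`. A relation takes the place of a function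
-- because an image is built from a proof of `OU/EU`, and independence of that proof then never has
-- to be shown.
length-≤-of-injective-relation : ∀ (R : A → B → Set) {xs ys} → Unique xs →
  (∀ {x} → x ∈ xs → ∃[ y ] y ∈ ys × R x y) →
  (∀ {x x′ y} → R x y → R x′ y → x ≡ x′) →
  length xs ≤ length ys
length-≤-of-injective-relation R [] total inj = z≤n
length-≤-of-injective-relation R {x ∷ xs} (x∉ ∷ u) total inj
  with total (here refl)
... | y , y∈ , r with ∈-∃++ y∈
... | as , bs , refl = subst (suc (length xs) ≤_) (sym (length-++-sucʳ as y bs))
  (s≤s (length-≤-of-injective-relation R u total′ inj))
  where
  total′ : ∀ {x′} → x′ ∈ xs → ∃[ y′ ] y′ ∈ as ++ bs × R x′ y′
  total′ x′∈ with total (there x′∈)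
  ... | y′ , y′∈ , r′ with ∈-++⁻ as y′∈
  ... | inj₁ ∈as         = y′ , ∈-++⁺ˡ ∈as , r′
  -- A second use of `y` would give `x ≡ x′`, against uniqueness.
  ... | inj₂ (here refl) = contradiction (inj r r′) (All.lookup x∉ x′∈)
  ... | inj₂ (there ∈bs) = y′ , ∈-++⁺ʳ as ∈bs , r′

-- No `x` is related to `w`, so `w` can be struck from `ys` before the lengths are compared.
length-<-of-injective-relation : ∀ (R : A → B → Set) {xs ys w} → Unique xs →
  (∀ {x} → x ∈ xs → ∃[ y ] y ∈ ys × R x y) →
  (∀ {x x′ y} → R x y → R x′ y → x ≡ x′) →
  w ∈ ys → (∀ {x} → ¬ R x w) →
  length xs < length ys
length-<-of-injective-relation R {xs} {w = w} u total inj w∈ ¬Rw with ∈-∃++ w∈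
... | as , bs , refl = subst (length xs <_) (sym (length-++-sucʳ as w bs))
  (s≤s (length-≤-of-injective-relation R u total′ inj))
  where
  total′ : ∀ {x} → x ∈ xs → ∃[ y ] y ∈ as ++ bs × R x y
  total′ x∈ with total x∈
  ... | y , y∈ , r with ∈-++⁻ as y∈
  ... | inj₁ ∈as         = y , ∈-++⁺ˡ ∈as , r
  ... | inj₂ (here refl) = contradiction r ¬Rw
  ... | inj₂ (there ∈bs) = y , ∈-++⁺ʳ as ∈bs , r

-- Parity.

even-+2⁻ : Even (2 + n) → Even n
even-+2⁻ e = ∣m+n∣m⇒∣n e ∣-refl

even-+2 : Even n → Even (2 + n)
even-+2 e = ∣m∣n⇒∣m+n ∣-refl e

odd-1 : Odd 1
odd-1 (divides zero ())
odd-1 (divides (suc q) ())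

even-double : ∀ m → Even (2 * m)
even-double m = m∣m*n m

odd-suc-double : ∀ m → Odd (suc (2 * m))
odd-suc-double m e = odd-1 (∣m+n∣m⇒∣n (subst Even (+-comm 1 (2 * m)) e) (even-double m))

halve : ∀ n → (∃[ h ] n ≡ 2 * h) ⊎ (∃[ h ] n ≡ suc (2 * h))
halve zero = inj₁ (0 , refl)
halve (suc n) with halve n
... | inj₁ (h , refl) = inj₂ (h , refl)
... | inj₂ (h , refl) = inj₁ (suc h , cong suc (sym (+-suc h (h + 0))))

even⇒double : Even n → ∃[ h ] n ≡ 2 * h
even⇒double (divides q eq) = q , trans eq (*-comm q 2)

odd⇒suc-double : Odd n → ∃[ h ] n ≡ suc (2 * h)
odd⇒suc-double {n} o with halve n
... | inj₁ (h , refl) = contradiction (even-double h) o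
... | inj₂ p          = p

odd-suc⇒even : Odd (suc n) → Even n
odd-suc⇒even {n} o with halve n
... | inj₁ (h , refl) = even-double h
... | inj₂ (h , refl) =
  contradiction (subst Even (cong suc (+-suc h (h + 0))) (even-double (suc h))) o

double≢suc-double : ∀ m n → 2 * m ≢ suc (2 * n)
double≢suc-double m n eq = odd-suc-double n (subst Even eq (even-double m))

-- Multiplicities.

mult-∷-≡ : ∀ k xs → mult k (k ∷ xs) ≡ suc (mult k xs)
mult-∷-≡ k xs = cong length (filter-accept (_≟ k) refl)

mult-∷-≢ : ∀ xs → a ≢ k → mult k (a ∷ xs) ≡ mult k xs
mult-∷-≢ {k = k} xs a≢k = cong length (filter-reject (_≟ k) a≢k)

mult-++ : ∀ k xs ys → mult k (xs ++ ys) ≡ mult k xs + mult k ys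
mult-++ k xs ys = trans (cong length (filter-++ (_≟ k) xs ys)) (length-++ (filter (_≟ k) xs))

mult-none : All (_≢ k) xs → mult k xs ≡ 0
mult-none ≢k = cong length (filter-none (_≟ _) ≢k)

mult-replicate : ∀ k m → mult k (replicate m k) ≡ m
mult-replicate k zero    = refl
mult-replicate k (suc m) = trans (mult-∷-≡ k (replicate m k)) (cong suc (mult-replicate k m))

-- Lists made of equal pairs.

dup : List A → List A
dup []       = []
dup (x ∷ xs) = x ∷ x ∷ dup xs

All-dup⁺ : ∀ {P : A → Set} {xs} → All P xs → All P (dup xs)
All-dup⁺ []       = []
All-dup⁺ (p ∷ ps) = p ∷ p ∷ All-dup⁺ ps

All-dup⁻ : ∀ {P : A → Set} xs → All P (dup xs) → All P xs
All-dup⁻ []       []           = []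
All-dup⁻ (x ∷ xs) (p ∷ _ ∷ ps) = p ∷ All-dup⁻ xs ps

dup-injective : ∀ {xs ys : List A} → dup xs ≡ dup ys → xs ≡ ys
dup-injective {xs = []}     {[]}     eq = refl
dup-injective {xs = x ∷ xs} {y ∷ ys} eq =
  let x≡y , eq′ = ∷-injective eq in cong₂ _∷_ x≡y (dup-injective (proj₂ (∷-injective eq′)))

sum-dup : ∀ xs → sum (dup xs) ≡ 2 * sum xs
sum-dup []       = refl
sum-dup (x ∷ xs) = trans (cong (λ s → x + (x + s)) (sum-dup xs)) (lemma x (sum xs))
  where
  lemma : ∀ x s → x + (x + 2 * s) ≡ 2 * (x + s)
  lemma = solve-∀

mult-dup-even : ∀ k xs → Even (mult k (dup xs))
mult-dup-even k [] = 2 ∣0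
mult-dup-even k (x ∷ xs) with x ≟ k
... | yes refl = subst Even
  (sym (trans (mult-∷-≡ k (k ∷ dup xs)) (cong suc (mult-∷-≡ k (dup xs))))) (even-+2 (mult-dup-even k xs))
... | no x≢k = subst Even
  (sym (trans (mult-∷-≢ (x ∷ dup xs) x≢k) (mult-∷-≢ (dup xs) x≢k))) (mult-dup-even k xs)

-- Non-increasing lists.

Sorted : List ℕ → Set
Sorted = AllPairs _≥_

Sorted-dup⁺ : Sorted xs → Sorted (dup xs)
Sorted-dup⁺ []       = []
Sorted-dup⁺ (p ∷ ps) = (≤-refl ∷ All-dup⁺ p) ∷ All-dup⁺ p ∷ Sorted-dup⁺ ps

Sorted-dup⁻ : ∀ xs → Sorted (dup xs) → Sorted xs
Sorted-dup⁻ []       []                 = []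
Sorted-dup⁻ (x ∷ xs) ((_ ∷ p) ∷ _ ∷ ps) = All-dup⁻ xs p ∷ Sorted-dup⁻ xs ps

Sorted-++⁻ : ∀ xs → Sorted (xs ++ ys) → Sorted xs × All (λ x → All (x ≥_) ys) xs × Sorted ys
Sorted-++⁻ []       s       = [] , [] , s
Sorted-++⁻ (x ∷ xs) (p ∷ s) =
  let sx , c , sy = Sorted-++⁻ xs s ; px , py = All.++⁻ xs p in px ∷ sx , py ∷ c , sy

Sorted-replicate : ∀ m k → Sorted (replicate m k)
Sorted-replicate zero    k = []
Sorted-replicate (suc m) k = All.replicate⁺ m ≤-refl ∷ Sorted-replicate m k

all-map : ∀ {f : A → ℕ} {P : ℕ → Set} → (∀ {y} → P y → ∃[ x ] y ≡ f x) →
          All P ys → ∃[ xs ] ys ≡ map f xs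
all-map pre [] = [] , refl
all-map pre (p ∷ ps) with pre p | all-map pre ps
... | x , refl | xs , refl = x ∷ xs , refl

-- Among the codes of even parts a zero stands for a 2, so this splits off the pairs of twos that
-- are set aside.
split-zeros : Sorted xs → ∃₂ λ ys t → xs ≡ ys ++ replicate t 0 × All (0 <_) ys
split-zeros [] = [] , 0 , refl , []
split-zeros {zero ∷ xs} (p ∷ s) with split-zeros s
... | [] , t , refl , []     = [] , suc t , refl , []
... | y ∷ ys , t , refl , 0<y ∷ _ with p
... | y≤0 ∷ _ = contradiction 0<y (≤⇒≯ y≤0)
split-zeros {suc x ∷ xs} (p ∷ s) with split-zeros s
... | ys , t , refl , pos = suc x ∷ ys , t , refl , z<s ∷ pos

-- Among the codes of odd parts a final zero stands for a pair of ones, the one that is set aside.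
ends-in-zero : Sorted xs → All (0 <_) xs ⊎ (∃[ ys ] xs ≡ ys ++ [ 0 ])
ends-in-zero [] = inj₁ []
ends-in-zero {x ∷ xs} (p ∷ s) with ends-in-zero s
... | inj₂ (ys , refl) = inj₂ (x ∷ ys , refl)
ends-in-zero {zero ∷ []}    (p ∷ s) | inj₁ _ = inj₂ ([] , refl)
ends-in-zero {zero ∷ _ ∷ _} ((y≤0 ∷ _) ∷ s) | inj₁ (0<y ∷ _) = contradiction 0<y (≤⇒≯ y≤0)
ends-in-zero {suc x ∷ xs}   (p ∷ s) | inj₁ pos = inj₁ (z<s ∷ pos)

-- The final block can be recognised because `xs` and `ys` avoid `a`.
++-replicate-injective : All (_≢ a) xs → All (_≢ a) ys →
  xs ++ replicate m a ≡ ys ++ replicate n a → xs ≡ ys × m ≡ n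
++-replicate-injective {m = m} {n} [] [] eq =
  refl , trans (sym (length-replicate m)) (trans (cong length eq) (length-replicate n))
++-replicate-injective {m = suc m} [] (y≢a ∷ _) eq = contradiction (sym (proj₁ (∷-injective eq))) y≢a
++-replicate-injective {n = suc n} (x≢a ∷ _) [] eq = contradiction (proj₁ (∷-injective eq)) x≢a
++-replicate-injective (_ ∷ ps) (_ ∷ qs) eq with ∷-injective eq
... | refl , eq′ with ++-replicate-injective ps qs eq′
... | refl , m≡n = refl , m≡n

-- Splitting a sorted list into pairs by the parity of multiplicities.

mult-∉ : ∀ {xs} → ¬ k ∈ xs → mult k xs ≡ 0
mult-∉ k∉ = mult-none (All.tabulate λ x∈ x≡k → k∉ (subst (_∈ _) x≡k x∈))

-- A value that does not occur has multiplicity 0. The condition for all `a`, not only for members,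
-- passes on easily when a pair is removed.
even-mult : All (λ a → Even (mult a xs)) xs → ∀ a → Even (mult a xs)
even-mult {xs} ev a with a ∈? xs
... | yes a∈ = All.lookup ev a∈
... | no a∉  = subst Even (sym (mult-∉ a∉)) (2 ∣0)

-- If `y < x`, then all later entries are below `x` as well, and `x` occurs just once.
head-repeated : ∀ {x y} → Sorted (x ∷ y ∷ zs) → Even (mult x (x ∷ y ∷ zs)) → x ≡ y
head-repeated {zs} {x} {y} ((y≤x ∷ _) ∷ ≤y ∷ _) ev with y ≟ x
... | yes y≡x = sym y≡x
... | no y≢x  = contradiction
  (subst Even (trans (mult-∷-≡ x (y ∷ zs)) (cong suc (mult-none {xs = y ∷ zs}
    (y≢x ∷ All.map (λ z≤y → <⇒≢ (≤-<-trans z≤y (≤∧≢⇒< y≤x y≢x))) ≤y)))) ev)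
  odd-1

odd-mult-singleton : ∀ x → Odd (mult x [ x ])
odd-mult-singleton x ev = odd-1 (subst Even (mult-∷-≡ x []) ev)

even-mult-drop₂ : ∀ x → Even (mult a (x ∷ x ∷ xs)) → Even (mult a xs)
even-mult-drop₂ {a} {xs} x ev with x ≟ a
... | yes refl = even-+2⁻ (subst Even (trans (mult-∷-≡ a (a ∷ xs)) (cong suc (mult-∷-≡ a xs))) ev)
... | no x≢a   = subst Even (trans (mult-∷-≢ (x ∷ xs) x≢a) (mult-∷-≢ xs x≢a)) ev

sorted-even⇒dup : Sorted xs → (∀ a → Even (mult a xs)) → ∃[ ys ] xs ≡ dup ys
sorted-even⇒dup {[]} _ _ = [] , refl
sorted-even⇒dup {x ∷ []} _ ev = contradiction (ev x) (odd-mult-singleton x)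
sorted-even⇒dup {x ∷ y ∷ xs} s@(_ ∷ _ ∷ s′) ev with head-repeated s (ev x)
... | refl with sorted-even⇒dup s′ (λ a → even-mult-drop₂ x (ev a))
... | ys , refl = x ∷ ys , refl

-- The `k` singled out is its first occurrence, hence `All (_≢ k) ys`; its further copies are even
-- in number and form pairs in `dup zs`.
sorted-odd⇒dup∷dup : Sorted xs → Odd (mult k xs) → (∀ a → a ≢ k → Even (mult a xs)) →
  ∃₂ λ ys zs → xs ≡ dup ys ++ k ∷ dup zs × All (_≢ k) ys
sorted-odd⇒dup∷dup {[]} _ od _ = contradiction (2 ∣0) od
sorted-odd⇒dup∷dup {x ∷ xs} {k} s od ev with x ≟ k
sorted-odd⇒dup∷dup {x ∷ xs} (_ ∷ s) od ev | yes refl =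
  let zs , eq = sorted-even⇒dup s ev′ in [] , zs , cong (x ∷_) eq , []
  where
  ev′ : ∀ a → Even (mult a xs)
  ev′ a with x ≟ a
  ... | yes refl = odd-suc⇒even (subst Odd (mult-∷-≡ x xs) od)
  ... | no x≢a   = subst Even (mult-∷-≢ xs x≢a) (ev a (x≢a ∘ sym))
sorted-odd⇒dup∷dup {x ∷ []} _ od ev | no x≢k = contradiction (ev x x≢k) (odd-mult-singleton x)
sorted-odd⇒dup∷dup {x ∷ y ∷ xs} {k} s@(_ ∷ _ ∷ s′) od ev | no x≢k with head-repeated s (ev x x≢k)
... | refl with sorted-odd⇒dup∷dup s′
                  (subst Odd (trans (mult-∷-≢ (x ∷ xs) x≢k) (mult-∷-≢ xs x≢k)) od)
                  (λ a a≢k → even-mult-drop₂ x (ev a a≢k))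
... | ys , zs , refl , ys≢k = x ∷ ys , zs , refl , x≢k ∷ ys≢k

-- Conjugation of partitions.

-- Adds a column of height r to a Young diagram with row lengths cs.
bump : ℕ → List ℕ → List ℕ
bump zero    cs       = cs
bump (suc r) []       = 1 ∷ bump r []
bump (suc r) (c ∷ cs) = suc c ∷ bump r cs

conjugate : List ℕ → List ℕ
conjugate = foldr bump []

sum-bump : ∀ r cs → sum (bump r cs) ≡ r + sum cs
sum-bump zero    cs       = refl
sum-bump (suc r) []       = cong suc (sum-bump r [])
sum-bump (suc r) (c ∷ cs) = cong suc (trans (cong (c +_) (sum-bump r cs)) (lemma c r (sum cs)))
  where
  lemma : ∀ c r s → c + (r + s) ≡ r + (c + s)
  lemma = solve-∀

length-bump : ∀ r cs → length cs ≤ r → length (bump r cs) ≡ r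
length-bump zero    []       _  = refl
length-bump (suc r) []       _  = cong suc (length-bump r [] z≤n)
length-bump (suc r) (c ∷ cs) le = cong suc (length-bump r cs (s≤s⁻¹ le))

bump-≤ : ∀ r {cs} → All (_≤ m) cs → All (_≤ suc m) (bump r cs)
bump-≤ zero    ps       = All.map m≤n⇒m≤1+n ps
bump-≤ (suc r) []       = s≤s z≤n ∷ bump-≤ r []
bump-≤ (suc r) (p ∷ ps) = s≤s p ∷ bump-≤ r ps

bump-positive : ∀ r {cs} → All (0 <_) cs → All (0 <_) (bump r cs)
bump-positive zero    ps       = ps
bump-positive (suc r) []       = z<s ∷ bump-positive r []
bump-positive (suc r) (p ∷ ps) = z<s ∷ bump-positive r ps

bump-sorted : ∀ r {cs} → Sorted cs → Sorted (bump r cs)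
bump-sorted zero    s       = s
bump-sorted (suc r) []      = bump-≤ r [] ∷ bump-sorted r []
bump-sorted (suc r) (p ∷ s) = bump-≤ r p ∷ bump-sorted r s

-- `bump` treats a missing row like a row of length 0; positivity keeps the two apart.
bump-injective : ∀ r {cs ds} → All (0 <_) cs → All (0 <_) ds → bump r cs ≡ bump r ds → cs ≡ ds
bump-injective zero    _ _ eq = eq
bump-injective (suc r) [] [] eq = refl
bump-injective (suc r) [] (0<d ∷ _) eq =
  contradiction (suc-injective (proj₁ (∷-injective eq))) (<⇒≢ 0<d)
bump-injective (suc r) (0<c ∷ _) [] eq =
  contradiction (sym (suc-injective (proj₁ (∷-injective eq)))) (<⇒≢ 0<c)
bump-injective (suc r) (_ ∷ ps) (_ ∷ qs) eq =
  let c≡d , eq′ = ∷-injective eq in cong₂ _∷_ (suc-injective c≡d) (bump-injective r ps qs eq′)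

sum-conjugate : ∀ rs → sum (conjugate rs) ≡ sum rs
sum-conjugate []       = refl
sum-conjugate (r ∷ rs) = trans (sum-bump r (conjugate rs)) (cong (r +_) (sum-conjugate rs))

-- A column adds at most 1 to each row. Hence the first entry of `image` bounds its other even
-- parts.
conjugate-≤ : ∀ rs → All (_≤ length rs) (conjugate rs)
conjugate-≤ []       = []
conjugate-≤ (r ∷ rs) = bump-≤ r (conjugate-≤ rs)

conjugate-positive : ∀ rs → All (0 <_) (conjugate rs)
conjugate-positive []       = []
conjugate-positive (r ∷ rs) = bump-positive r (conjugate-positive rs)

conjugate-sorted : ∀ rs → Sorted (conjugate rs)
conjugate-sorted []       = []
conjugate-sorted (r ∷ rs) = bump-sorted r (conjugate-sorted rs)

-- `foldr` adds the smallest parts first, so each new column is at least as tall as the diagram so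
-- far. Injectivity of conjugation reads the first part off from this length.
length-conjugate : ∀ {r rs} → Sorted (r ∷ rs) → length (conjugate (r ∷ rs)) ≡ r
length-conjugate {r} {[]} _ = length-bump r [] z≤n
length-conjugate {r} {r′ ∷ rs} ((r′≤r ∷ _) ∷ s) =
  length-bump r _ (subst (_≤ r) (sym (length-conjugate s)) r′≤r)

-- The lengths have to agree because conjugation forgets zeros.
conjugate-injective : ∀ {rs rs′} → Sorted rs → Sorted rs′ → length rs ≡ length rs′ →
                      conjugate rs ≡ conjugate rs′ → rs ≡ rs′
conjugate-injective {[]}     {[]}       _ _ _ _ = refl
conjugate-injective {r ∷ rs} {r′ ∷ rs′} s@(_ ∷ t) s′@(_ ∷ t′) len eq
  with trans (sym (length-conjugate s)) (trans (cong length eq) (length-conjugate s′))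
... | refl = cong (r ∷_) (conjugate-injective t t′ (suc-injective len)
  (bump-injective r (conjugate-positive rs) (conjugate-positive rs′) eq))

-- The image partition: injectivity, sum and membership in `EU/OU`.

-- 2 rs + 1 lists the parts of a partition into odd parts, zeros standing for
-- parts equal to 1. Apart from the 1s, the image is the conjugate of that
-- partition with all its parts doubled up.
image : List ℕ → ℕ → List ℕ
image rs s = 2 * length rs ∷ dup (map (2 *_) (conjugate rs)) ++ replicate (suc (2 * s)) 1

-- The doubled even parts differ from 1, so the final ones give `s`; the first part gives the length
-- of `rs` that `conjugate-injective` asks for.
image-injective : ∀ {rs rs′ s s′} → Sorted rs → Sorted rs′ → image rs s ≡ image rs′ s′ → rs ≡ rs′ × s ≡ s′
image-injective {rs} {rs′} {s} {s′} sr sr′ eq =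
  let h , t     = ∷-injective eq
      t₁ , t₂   = ++-replicate-injective (≢1 rs) (≢1 rs′) t
  in conjugate-injective sr sr′ (*-cancelˡ-≡ _ _ 2 h)
       (map-injective (λ {m} {n} → *-cancelˡ-≡ m n 2) (dup-injective t₁)) ,
     *-cancelˡ-≡ s s′ 2 (suc-injective t₂)
  where
  ≢1 : ∀ rs → All (_≢ 1) (dup (map (2 *_) (conjugate rs)))
  ≢1 rs = All-dup⁺ (All.map⁺ (All.universal (λ c → double≢suc-double c 0) (conjugate rs)))

sum-map-double : ∀ xs → sum (map (2 *_) xs) ≡ 2 * sum xs
sum-map-double []       = refl
sum-map-double (x ∷ xs) = trans (cong (2 * x +_) (sum-map-double xs)) (lemma x (sum xs))
  where
  lemma : ∀ x s → 2 * x + 2 * s ≡ 2 * (x + s)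
  lemma = solve-∀

sum-replicate : ∀ m k → sum (replicate m k) ≡ m * k
sum-replicate zero    k = refl
sum-replicate (suc m) k = cong (k +_) (sum-replicate m k)

-- Conjugation keeps the sum; doubling the parts and pairing them each give a factor 2. Compared
-- with `Encodes-sum`, the total grows by exactly 1.
sum-image : ∀ rs s → sum (image rs s) ≡ 2 * (length rs + 2 * sum rs + s) + 1
sum-image rs s = begin
  2 * L + sum (dup cs ++ ones)
    ≡⟨ cong (2 * L +_) (sum-++ (dup cs) ones) ⟩
  2 * L + (sum (dup cs) + sum ones)
    ≡⟨ cong (2 * L +_) (cong₂ _+_
         (trans (sum-dup cs) (cong (2 *_)
           (trans (sum-map-double (conjugate rs)) (cong (2 *_) (sum-conjugate rs)))))
         (sum-replicate (suc (2 * s)) 1)) ⟩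
  2 * L + (2 * (2 * sum rs) + suc (2 * s) * 1)
    ≡⟨ lemma L (sum rs) s ⟩
  2 * (L + 2 * sum rs + s) + 1 ∎
  where
  open ≡-Reasoning
  L    = length rs
  cs   = map (2 *_) (conjugate rs)
  ones = replicate (suc (2 * s)) 1
  lemma : ∀ L r s → 2 * L + (2 * (2 * r) + suc (2 * s) * 1) ≡ 2 * (L + 2 * r + s) + 1
  lemma = solve-∀

odd-suc : Even n → Odd (suc n)
odd-suc {n} e e′ = odd-1 (∣m+n∣m⇒∣n (subst Even (+-comm 1 n) e′) e)

-- Stated for a general odd part `l`: the images need `l = 1`, the missed partition `l = 3`.
eu/ou-∈ : ∀ k l s {es} → Even k → Odd l → 0 < l → l < k →
  All Even es → All (_≤ k) es → All (l <_) es → Sorted es →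
  let xs = k ∷ dup es ++ replicate (suc (2 * s)) l in
  sum xs ≡ m → xs ∈ filter eu/ou? (partitions m)
eu/ou-∈ k l s {es} even-k odd-l 0<l l<k es-even es≤k l<es es-sorted sum≡ = ∈-filter⁺ eu/ou?
  (∈-partitions⁺ (isPartition (AllPairs⇒Linked sorted) (All.map (≤-trans 0<l) l≤) sum≡))
  -- An odd part is always `l`, and an even part `a ≥ l` cannot equal the odd `l`.
  ( All.map (λ l≤a → All.map (λ odd≡l even-a odd-b → subst (_< _) (sym (odd≡l odd-b))
      (≤∧≢⇒< l≤a λ where refl → odd-l even-a)) odd≡l) l≤
  , here (lose l∈
      ( (even-k , All.map (λ a≤k _ → a≤k) ≤k) , odd-mult-k
      , (odd-l , All.map (λ odd≡l odd-b → ≤-reflexive (odd≡l odd-b)) odd≡l) , odd-mult-l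
      , All.universal even-mult-other parts)))
  where
  ls = replicate (suc (2 * s)) l
  parts = k ∷ dup es ++ ls
  l∈ : l ∈ parts
  l∈ = there (∈-insert (dup es))
  ≤k : All (_≤ k) parts
  ≤k = ≤-refl ∷ All.++⁺ (All-dup⁺ es≤k) (All.replicate⁺ (suc (2 * s)) (<⇒≤ l<k))
  l≤ : All (l ≤_) parts
  l≤ = <⇒≤ l<k ∷ All.++⁺ (All-dup⁺ (All.map <⇒≤ l<es)) (All.replicate⁺ (suc (2 * s)) ≤-refl)
  sorted : Sorted parts
  sorted = All.tail ≤k ∷ AllPairs.++⁺ (Sorted-dup⁺ es-sorted) (Sorted-replicate (suc (2 * s)) l)
    (All.map (All.replicate⁺ (suc (2 * s)) ∘ <⇒≤) (All-dup⁺ l<es))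
  odd≡l : All (λ b → Odd b → b ≡ l) parts
  odd≡l = (λ odd-k → contradiction even-k odd-k) ∷ All.++⁺
    (All-dup⁺ (All.map (λ even odd → contradiction even odd) es-even))
    (All.replicate⁺ (suc (2 * s)) (λ _ → refl))
  even-mult-tail : ∀ {a} → a ≢ l → Even (mult a (dup es ++ ls))
  even-mult-tail {a} a≢l = subst Even
    (sym (trans (mult-++ a (dup es) ls)
      (trans (cong (mult a (dup es) +_) (mult-none (All.replicate⁺ (suc (2 * s)) (a≢l ∘ sym))))
             (+-identityʳ _))))
    (mult-dup-even a es)
  -- Further copies of `k` in `dup es` come in pairs.
  odd-mult-k : Odd (mult k parts)
  odd-mult-k = subst Odd (sym (mult-∷-≡ k (dup es ++ ls)))
    (odd-suc (even-mult-tail λ where refl → <-irrefl refl l<k))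
  odd-mult-l : Odd (mult l parts)
  odd-mult-l = subst Odd
    (sym (trans (mult-∷-≢ {a = k} {k = l} (dup es ++ ls) λ where refl → <-irrefl refl l<k)
      (trans (mult-++ l (dup es) ls)
        (cong₂ _+_ (mult-none (All-dup⁺ (All.map (λ l<e e≡l → <⇒≢ l<e (sym e≡l)) l<es)))
                   (mult-replicate l (suc (2 * s)))))))
    (odd-suc-double s)
  even-mult-other : ∀ a → a ≢ k → a ≢ l → Even (mult a parts)
  even-mult-other a a≢k a≢l = subst Even (sym (mult-∷-≢ (dup es ++ ls) (a≢k ∘ sym))) (even-mult-tail a≢l)

1<double : 0 < m → 1 < 2 * m
1<double {m} 0<m = *-monoʳ-≤ 2 0<m

-- A nonempty `rs` makes the first part at least 2, hence larger than the ones.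
image-∈ : ∀ rs s → 0 < length rs → length rs + 2 * sum rs + s ≡ n →
          image rs s ∈ filter eu/ou? (partitions (2 * n + 1))
image-∈ rs s 0<L refl = eu/ou-∈ (2 * length rs) 1 s (even-double (length rs)) odd-1 z<s (1<double 0<L)
  (All.map⁺ (All.universal even-double (conjugate rs)))
  (All.map⁺ (All.map (*-monoʳ-≤ 2) (conjugate-≤ rs)))
  (All.map⁺ (All.map 1<double (conjugate-positive rs)))
  (AllPairs.map⁺ (AllPairs.map (*-monoʳ-≤ 2) (conjugate-sorted rs)))
  (sum-image rs s)

-- The encoding by odd parts and its injectivity.

-- The shift gives an even part `2 * suc p` the same code `p` as the odd part `2 * p + 1` that it
-- becomes.
odds evens : List ℕ → List ℕ
odds  = map (λ o → suc (2 * o))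
evens = map (λ p → 2 * suc p)

-- The codes list one member of each pair. So `2 * k` ones appear as `k` zeros, and each pair coded
-- in `ps` contributes one more zero.
data Encodes : List ℕ → ℕ → List ℕ → Set where
  -- The first two constructors cover the partitions without even parts.
  no-ones : ∀ {os} → Sorted os → All (0 <_) os → Encodes os 0 (dup (odds os))
  ones    : ∀ {os} → Sorted os → Encodes os 1 (dup (odds (os ++ [ 0 ])))
  -- An even part 2 p + 2 > 2 becomes 2 p + 1 and a 1, the lone largest even part
  -- 2 k becomes 2 k ones, and the t pairs of 2s go to the ones that image appends.
  lone    : ∀ {k os ps} t → 0 < k → Sorted (os ++ ps ++ replicate (k + length ps) 0) →
            All (k ≤_) os → All (0 <_) ps → All (_< k) ps →
            Encodes (os ++ ps ++ replicate (k + length ps) 0) (2 * t)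
                    (dup (odds os) ++ 2 * k ∷ dup (evens (ps ++ replicate t 0)))

Encodes-sorted : ∀ {rs s} → Encodes rs s xs → Sorted rs
Encodes-sorted (no-ones s _)        = s
Encodes-sorted (ones s)             = s
Encodes-sorted (lone _ _ s _ _ _)   = s

0<⇒≢0 : All (0 <_) xs → All (_≢ 0) xs
0<⇒≢0 = All.map (λ 0<x x≡0 → <⇒≢ 0<x (sym x≡0))

-- The higher threshold `k′` cuts off the shorter prefix: `os′` cannot reach into `ps`, whose
-- entries are below `k ≤ k′`.
split-unique : ∀ {os os′ ps ps′ k k′} → k ≤ k′ →
  All (_< k) ps → All (k′ ≤_) os′ → os ++ ps ≡ os′ ++ ps′ →
  ∃[ ms ] os ≡ os′ ++ ms × ps′ ≡ ms ++ ps
split-unique {os} {[]} _ _ _ eq = os , refl , sym eq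
split-unique {[]} {_ ∷ _} k≤k′ (p<k ∷ _) (k′≤o ∷ _) refl =
  contradiction (≤-trans k≤k′ k′≤o) (λ k≤p → ≤⇒≯ k≤p p<k)
split-unique {o ∷ os} {o′ ∷ os′} k≤k′ ps<k (_ ∷ k′≤os′) eq with ∷-injective eq
... | refl , eq′ with split-unique {os} {os′} k≤k′ ps<k k′≤os′ eq′
... | ms , refl , ps′≡ = ms , refl , ps′≡

-- This is the strict growth in `k` of the number of zeros: raising the threshold can only lengthen
-- `ps`, so equal numbers of zeros force equal thresholds.
split-unique-≤ : ∀ {os os′ ps ps′ k k′} → k ≤ k′ →
  All (_< k) ps → All (k′ ≤_) os′ → os ++ ps ≡ os′ ++ ps′ → k + length ps ≡ k′ + length ps′ →
  k ≡ k′ × os ≡ os′ × ps ≡ ps′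
split-unique-≤ {os} {os′} {ps} {ps′} {k} {k′} k≤k′ ps<k k′≤os′ eq len
  with split-unique {os} {os′} k≤k′ ps<k k′≤os′ eq
... | [] , refl , refl = +-cancelʳ-≡ (length ps) k k′ len , ++-identityʳ os′ , refl
-- Cancelling `length ps` would leave `k ≡ suc (k′ + length ms)`, so `k′ < k`.
... | m ∷ ms , refl , refl = contradiction (m≤m+n k′ (length ms)) (λ k′≤ → ≤⇒≯ k≤k′ (≤-trans (s≤s k′≤)
  (≤-reflexive (sym (+-cancelʳ-≡ (length ps) k (suc (k′ + length ms)) (trans len
    (trans (cong (k′ +_) (cong suc (length-++ ms))) (lemma k′ (length ms) (length ps)))))))))
  where
  lemma : ∀ k m p → k + suc (m + p) ≡ suc (k + m) + p
  lemma = solve-∀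

split-injective : ∀ {os os′ ps ps′ k k′} →
  All (k ≤_) os → All (k′ ≤_) os′ → All (_< k) ps → All (_< k′) ps′ →
  os ++ ps ≡ os′ ++ ps′ → k + length ps ≡ k′ + length ps′ →
  k ≡ k′ × os ≡ os′ × ps ≡ ps′
split-injective {k = k} {k′} k≤os k′≤os′ ps<k ps′<k′ eq len with ≤-total k k′
... | inj₁ k≤k′ = split-unique-≤ k≤k′ ps<k k′≤os′ eq len
... | inj₂ k′≤k =
  let k≡ , os≡ , ps≡ = split-unique-≤ k′≤k ps′<k′ k≤os (sym eq) (sym len) in sym k≡ , sym os≡ , sym ps≡

-- As `0 < k`, the block of zeros is not empty. This tells `lone` from `no-ones`.
¬positive : ∀ os ps → 0 < k → ¬ All (0 <_) (os ++ ps ++ replicate (k + m) 0)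
¬positive {suc k} os ps _ pos with All.++⁻ʳ ps (All.++⁻ʳ os pos)
... | () ∷ _

-- The parity of `s` separates `ones` from the other constructors, and a zero in `rs` separates
-- `lone` from `no-ones`. Within `lone`, `s` gives `t` and `rs` gives the rest.
Encodes-injective : ∀ {rs rs′ s s′} → Encodes rs s xs → Encodes rs′ s′ ys →
                    rs ≡ rs′ → s ≡ s′ → xs ≡ ys
Encodes-injective (no-ones _ _) (no-ones _ _) refl _ = refl
Encodes-injective (no-ones _ pos) (lone {os = os} {ps} t 0<k _ _ _ _) refl _ =
  contradiction pos (¬positive os ps 0<k)
Encodes-injective (ones _) (ones _) refl _ = refl
Encodes-injective (ones _) (lone t _ _ _ _ _) _ 1≡2t =
  contradiction (sym 1≡2t) (double≢suc-double t 0)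
Encodes-injective (lone {os = os} {ps} t 0<k _ _ _ _) (no-ones _ pos) refl _ =
  contradiction pos (¬positive os ps 0<k)
Encodes-injective (lone t _ _ _ _ _) (ones _) _ 2t≡1 =
  contradiction 2t≡1 (double≢suc-double t 0)
Encodes-injective (lone {k} {os} {ps} t 0<k _ k≤os 0<ps ps<k)
                  (lone {k′} {os′} {ps′} t′ 0<k′ _ k′≤os′ 0<ps′ ps′<k′) rs≡ 2t≡2t′
  with *-cancelˡ-≡ t t′ 2 2t≡2t′
     -- All entries of `os ++ ps` are positive, so `rs` determines this list and the number of
     -- zeros.
     | ++-replicate-injective (nonzero 0<k k≤os 0<ps) (nonzero 0<k′ k′≤os′ 0<ps′)
         (trans (++-assoc os ps _) (trans rs≡ (sym (++-assoc os′ ps′ _))))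
  where
  nonzero : ∀ {k os ps} → 0 < k → All (k ≤_) os → All (0 <_) ps → All (_≢ 0) (os ++ ps)
  nonzero 0<k k≤os 0<ps = 0<⇒≢0 (All.++⁺ (All.map (≤-trans 0<k) k≤os) 0<ps)
... | refl | parts≡ , zeros≡ with split-injective k≤os k′≤os′ ps<k ps′<k′ parts≡ zeros≡
... | refl , refl , refl = refl

-- Sums and lengths of encodings.

sum-odds : ∀ os → sum (odds os) ≡ length os + 2 * sum os
sum-odds []       = refl
sum-odds (o ∷ os) = trans (cong (suc (2 * o) +_) (sum-odds os)) (lemma o (length os) (sum os))
  where
  lemma : ∀ o l s → suc (2 * o) + (l + 2 * s) ≡ suc l + 2 * (o + s)
  lemma = solve-∀

sum-evens : ∀ ps → sum (evens ps) ≡ 2 * (length ps + sum ps)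
sum-evens []       = refl
sum-evens (p ∷ ps) = trans (cong (2 * suc p +_) (sum-evens ps)) (lemma p (length ps) (sum ps))
  where
  lemma : ∀ p l s → 2 * suc p + 2 * (l + s) ≡ 2 * (suc l + (p + s))
  lemma = solve-∀

sum-++-zeros : ∀ xs m → sum (xs ++ replicate m 0) ≡ sum xs
sum-++-zeros xs m = trans (sum-++ xs (replicate m 0))
  (trans (cong (sum xs +_) (trans (sum-replicate m 0) (*-zeroʳ m))) (+-identityʳ (sum xs)))

length-++-replicate : ∀ xs m → length (xs ++ replicate m a) ≡ length xs + m
length-++-replicate xs m = trans (length-++ xs) (cong (length xs +_) (length-replicate m))

-- Each entry `r` of `rs` accounts for two parts `2 * r + 1`, and `s` is half the sum of what is set
-- aside.
Encodes-sum : ∀ {rs s} → Encodes rs s xs → sum xs ≡ 2 * (length rs + 2 * sum rs + s)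
Encodes-sum (no-ones {os} _ _) = trans (sum-dup (odds os)) (cong (2 *_)
  (trans (sum-odds os) (sym (+-identityʳ (length os + 2 * sum os)))))
Encodes-sum (ones {os} _) = trans (sum-dup (odds (os ++ [ 0 ]))) (cong (2 *_)
  (trans (sum-odds (os ++ [ 0 ]))
    (trans (cong₂ (λ l s → l + 2 * s) (length-++-replicate os 1) (sum-++-zeros os 1))
      (lemma (length os) (sum os)))))
  where
  lemma : ∀ l s → l + 1 + 2 * s ≡ l + 2 * s + 1
  lemma = solve-∀
Encodes-sum (lone {k} {os} {ps} t _ _ _ _ _) = begin
  sum (dup (odds os) ++ 2 * k ∷ dup (evens qs))
    ≡⟨ sum-++ (dup (odds os)) (2 * k ∷ dup (evens qs)) ⟩
  sum (dup (odds os)) + (2 * k + sum (dup (evens qs)))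
    ≡⟨ cong₂ (λ x y → x + (2 * k + y))
         (trans (sum-dup (odds os)) (cong (2 *_) (sum-odds os)))
         (trans (sum-dup (evens qs)) (cong (2 *_) (trans (sum-evens qs) (cong (2 *_)
           (cong₂ _+_ (length-++-replicate ps t) (sum-++-zeros ps t)))))) ⟩
  2 * (length os + 2 * sum os) + (2 * k + 2 * (2 * (length ps + t + sum ps)))
    ≡⟨ lemma k (length os) (sum os) (length ps) (sum ps) t ⟩
  2 * (length os + (length ps + (k + length ps)) + 2 * (sum os + sum ps) + 2 * t)
    ≡⟨ cong₂ (λ l s → 2 * (l + 2 * s + 2 * t))
         (trans (length-++ os) (cong (length os +_) (length-++-replicate ps z)))
         (trans (sum-++ os (ps ++ replicate z 0)) (cong (sum os +_) (sum-++-zeros ps z))) ⟨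
  2 * (length rs + 2 * sum rs + 2 * t) ∎
  where
  open ≡-Reasoning
  z  = k + length ps
  qs = ps ++ replicate t 0
  rs = os ++ ps ++ replicate z 0
  lemma : ∀ k o so p sp t →
          2 * (o + 2 * so) + (2 * k + 2 * (2 * (p + t + sp))) ≡
          2 * (o + (p + (k + p)) + 2 * (so + sp) + 2 * t)
  lemma = solve-∀

-- The bound excludes the empty partition and 1 + 1, the latter being encoded by `ones` with an
-- empty list.
Encodes-nonempty : ∀ {rs s} → Encodes rs s xs → 2 < sum xs → 0 < length rs
Encodes-nonempty (no-ones {os} _ _) = nonempty os
  where
  nonempty : ∀ os → 2 < sum (dup (odds os)) → 0 < length os
  nonempty (_ ∷ _) _ = z<s
Encodes-nonempty (ones {os} _) = nonempty os
  where
  nonempty : ∀ os → 2 < sum (dup (odds (os ++ [ 0 ]))) → 0 < length os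
  nonempty []      (s≤s (s≤s ()))
  nonempty (_ ∷ _) _ = z<s
Encodes-nonempty (lone {suc k} {os} {ps} _ _ _ _ _ _) _ = subst (0 <_)
  (sym (trans (length-++ os) (cong (length os +_) (length-++-replicate ps (suc k + length ps)))))
  (<-≤-trans (<-≤-trans (z<s {k + length ps}) (m≤n+m _ (length ps))) (m≤n+m _ (length os)))

-- Existence of an encoding for every `OU/EU` partition.

Sorted-odds⁻ : ∀ os → Sorted (odds os) → Sorted os
Sorted-odds⁻ os s = AllPairs.map (*-cancelˡ-≤ 2 ∘ s≤s⁻¹) (AllPairs.map⁻ s)

Sorted-evens⁻ : ∀ ps → Sorted (evens ps) → Sorted ps
Sorted-evens⁻ ps s = AllPairs.map (s≤s⁻¹ ∘ *-cancelˡ-≤ 2) (AllPairs.map⁻ s)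

encode-odd : Sorted xs → All Odd xs → All (λ a → Even (mult a xs)) xs →
             ∃₂ λ rs s → Encodes rs s xs
encode-odd {xs} s odd ev with sorted-even⇒dup s (even-mult ev)
... | ys , refl with all-map {f = λ o → suc (2 * o)} odd⇒suc-double (All-dup⁻ ys odd)
... | os , refl with Sorted-odds⁻ os (Sorted-dup⁻ (odds os) s)
... | os-sorted with ends-in-zero os-sorted
... | inj₁ pos          = os , 0 , no-ones os-sorted pos
... | inj₂ (os′ , refl) = os′ , 1 , ones (proj₁ (Sorted-++⁻ os′ os-sorted))

lone-even : 0 < k → Even k → Sorted (dup ys ++ k ∷ dup zs) →
            All Odd ys → All (λ z → Even z × 0 < z) zs →
            ∃₂ λ rs s → Encodes rs s (dup ys ++ k ∷ dup zs)
lone-even {k} {ys} {zs} 0<k even-k s odd-ys even-zs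
  with even⇒double even-k
     | all-map {f = λ o → suc (2 * o)} odd⇒suc-double odd-ys
     | all-map {f = λ p → 2 * suc p} halve-positive even-zs
  where
  halve-positive : ∀ {z} → Even z × 0 < z → ∃[ p ] z ≡ 2 * suc p
  halve-positive (even-z , 0<z) with even⇒double even-z
  ... | suc p , refl = p , refl
... | h , refl | os , refl | qs , refl
  with Sorted-++⁻ (dup (odds os)) s
... | s-os , os≥ , s-h∷qs@(≤h ∷ s-qs)
  with split-zeros (Sorted-evens⁻ qs (Sorted-dup⁻ (evens qs) s-qs))
... | ps , t , refl , 0<ps = rs , 2 * t , lone t 0<h rs-sorted h≤os 0<ps ps<h
  where
  rs = os ++ ps ++ replicate (h + length ps) 0
  0<h : 0 < h
  0<h = *-cancelˡ-< 2 0 h 0<k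
  h≤os : All (h ≤_) os
  -- From `2 * h ≤ 2 * o + 1` follows `2 * h < 2 * suc o`, hence `h ≤ o`.
  h≤os = All.map (λ {o} c → s≤s⁻¹ (*-cancelˡ-< 2 h (suc o)
      (≤-trans (s≤s (All.head c)) (≤-reflexive (sym (cong suc (+-suc o (o + 0))))))))
    (All.map⁻ (All-dup⁻ (odds os) os≥))
  -- The bound is strict although `2 * h` may recur in pairs, because `p` codes `2 * suc p`.
  ps<h : All (_< h) ps
  ps<h = All.++⁻ˡ ps (All.map (*-cancelˡ-≤ 2) (All.map⁻ (All-dup⁻ (evens qs) ≤h)))
  rs-sorted : Sorted rs
  rs-sorted = AllPairs.++⁺ (Sorted-odds⁻ os (Sorted-dup⁻ (odds os) s-os))
    (AllPairs.++⁺ (proj₁ (Sorted-++⁻ ps (Sorted-evens⁻ qs (Sorted-dup⁻ (evens qs) s-qs))))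
      (Sorted-replicate (h + length ps) 0)
      (All.universal (λ _ → All.replicate⁺ (h + length ps) z≤n) ps))
    (All.map (λ h≤o → All.++⁺ (All.map (λ p<h → ≤-trans (<⇒≤ p<h) h≤o) ps<h)
                              (All.replicate⁺ (h + length ps) z≤n)) h≤os)

encode : Sorted xs → All (0 <_) xs → OU/EU xs → ∃₂ λ rs s → Encodes rs s xs
encode s pos (_ , inj₂ (odd , ev)) = encode-odd s odd ev
encode {xs} s pos (above , inj₁ any) with find any
... | k , k∈ , (even-k , ≤k) , odd-mult , even-others
  with sorted-odd⇒dup∷dup s odd-mult even-mult-others
  where
  even-mult-others : ∀ a → a ≢ k → Even (mult a xs)
  even-mult-others a a≢k with a ∈? xs
  ... | yes a∈ = All.lookup even-others a∈ a≢k
  ... | no a∉  = subst Even (sym (mult-∉ a∉)) (2 ∣0)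
... | ys , zs , refl , ys≢k = lone-even (All.lookup pos k∈) even-k s odd-ys (All.zip (even-zs , 0<zs))
  where
  k<odd : All (λ a → Odd a → k < a) (dup ys ++ k ∷ dup zs)
  k<odd = All.map (λ below odd → All.lookup below k∈ odd even-k) above
  zs≤k : All (_≤ k) zs
  zs≤k = All-dup⁻ zs (AllPairs.head (proj₂ (proj₂ (Sorted-++⁻ (dup ys) s))))
  k≤ys : All (k ≤_) ys
  k≤ys = All-dup⁻ ys (All.map All.head (proj₁ (proj₂ (Sorted-++⁻ (dup ys) s))))
  0<zs : All (0 <_) zs
  0<zs = All-dup⁻ zs (All.tail (All.++⁻ʳ (dup ys) pos))
  -- An even entry of `ys` would be at most `k`, hence equal to `k`, which `ys` avoids.
  odd-ys : All Odd ys
  odd-ys = All.zipWith (λ ((k≤y , y≢k) , y≤k) even-y → y≢k (≤-antisym (y≤k even-y) k≤y))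
    (All.zip (k≤ys , ys≢k) , All-dup⁻ ys (All.++⁻ˡ (dup ys) ≤k))
  -- An odd entry would exceed `k`, but `zs` stays at or below it.
  even-zs : All Even zs
  even-zs = All.zipWith (λ (z≤k , k<z) → decidable-stable (even? _) (≤⇒≯ z≤k ∘ k<z))
    (zs≤k , All-dup⁻ zs (All.tail (All.++⁻ʳ (dup ys) k<odd)))

-- The strict inequality, from the injection and a missed partition.

theorem4p1 : (n : ℕ) → 3 ≤ n → p-ou/eu (2 * n) < p-eu/ou (2 * n + 1)
theorem4p1 n@(suc m) 3≤n@(s≤s 2≤m) = length-<-of-injective-relation R
  (Unique.filter⁺ ou/eu? (partitions-unique (2 * n))) total injective missed∈ missed
  where
  R : List ℕ → List ℕ → Set
  R xs ys = ∃₂ λ rs s → Encodes rs s xs × ys ≡ image rs s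

  total : ∀ {xs} → xs ∈ filter ou/eu? (partitions (2 * n)) →
          ∃[ ys ] ys ∈ filter eu/ou? (partitions (2 * n + 1)) × R xs ys
  total xs∈ with ∈-filter⁻ ou/eu? {xs = partitions (2 * n)} xs∈
  ... | xs∈p , ou/eu with ∈-partitions⁻ xs∈p
  ... | isPartition linked pos sum≡
    with encode (Linked⇒AllPairs (λ x≥y y≥z → ≤-trans y≥z x≥y) linked) pos ou/eu
  ... | rs , s , enc = image rs s , image-∈ rs s
    (Encodes-nonempty enc (subst (2 <_) (sym sum≡) (≤-trans 3≤n (m≤m+n n _))))
    (*-cancelˡ-≡ _ n 2 (trans (sym (Encodes-sum enc)) sum≡)) , rs , s , enc , refl

  injective : ∀ {xs xs′ ys} → R xs ys → R xs′ ys → xs ≡ xs′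
  injective (_ , _ , enc , refl) (_ , _ , enc′ , eq) =
    let rs≡ , s≡ = image-injective (Encodes-sorted enc) (Encodes-sorted enc′) eq
    in Encodes-injective enc enc′ rs≡ s≡

  missed∈ : 2 * m ∷ 3 ∷ [] ∈ filter eu/ou? (partitions (2 * n + 1))
  -- With `s = 0` the part 3 occurs once; it lies below `2 * m` because `2 ≤ m`.
  missed∈ = eu/ou-∈ (2 * m) 3 0 (even-double m) (odd-suc-double 1) z<s (*-monoʳ-≤ 2 2≤m)
    [] [] [] [] (lemma m)
    where
    lemma : ∀ m → 2 * m + 3 ≡ 2 * suc m + 1
    lemma = solve-∀

  missed : ∀ {xs} → ¬ R xs (2 * m ∷ 3 ∷ [])
  missed (rs , s , _ , eq)
    with subst (1 ∈_) (sym eq) (there (∈-insert (dup (map (2 *_) (conjugate rs)))))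
  ... | here 1≡2m      = double≢suc-double m 0 (sym 1≡2m)
  ... | there (here ())
  ... | there (there ())
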